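{- Let $\mathcal{Q}$ be a nonempty convex delta-matroid on a finite set $E$. Let $r=\max\{|S|:S\in\mathcal{Q}\}$, $s=\min\{|S|:S\in\mathcal{Q}\}$, $\ell=r-s$, let $\{1,\dots,\ell\}$ be $\ell$ new elements disjoint from $E$, $E^\flat=E\cup\{1,\dots,\ell\}$, and $\mathcal{Q}^\flat=\{S\subseteq E^\flat: |S|=r \text{ and } S\cap E\in\mathcal{Q}\}$. Then $\mathcal{Q}^\flat$ is the set of bases of a matroid on $E^\flat$.
   Context: $\mathcal{Q}\subseteq 2^E$ is convex if $S\subseteq T\subseteq S'$ with $S,S'\in\mathcal{Q}$ implies $T\in\mathcal{Q}$. $\mathcal{Q}$ is a delta-matroid if for all $A,B\in\mathcal{Q}$ and $e\in A\triangle B$ there is $f\in A\triangle B$ (possibly $f=e$) with $A\triangle\{e,f\}\in\mathcal{Q}$, where $\triangle$ is symmetric difference. -}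

module Defs where

open import Level using (Level; suc)
open import Data.Nat using (ℕ; _+_; _≤_; _≥_)
open import Data.Fin using (Fin)
open import Data.Fin.Subset using (Subset; _∈_; _∉_; _⊆_; _∪_; _─_; _-_; ⁅_⁆; ∣_∣)
open import Data.Product using (_×_; ∃-syntax)
open import Data.Vec using (take)
open import Relation.Binary.PropositionalEquality using (_≡_)
open import Relation.Unary using (Pred; Satisfiable)

private
  variable
    p : Level
    n : ℕ

-- The finite ground set E is Fin n.  Families of subsets are arbitrary
-- predicates; they are not assumed to be decidable.

infixr 6 _△_

_△_ : Subset n → Subset n → Subset n
A △ B = (A ─ B) ∪ (B ─ A)

Convex : Pred (Subset n) p → Set p
Convex Q = ∀ {S T S′} → S ⊆ T → T ⊆ S′ → Q S → Q S′ → Q T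

DeltaMatroid : Pred (Subset n) p → Set p
DeltaMatroid Q = ∀ {A B} → Q A → Q B → ∀ {e} → e ∈ A △ B →
  ∃[ f ] (f ∈ A △ B × Q (A △ (⁅ e ⁆ ∪ ⁅ f ⁆)))

-- { |S| : S ∈ Q }
Sizes : Pred (Subset n) p → Pred ℕ p
Sizes Q k = ∃[ S ] (Q S × ∣ S ∣ ≡ k)

IsMax : Pred ℕ p → ℕ → Set p
IsMax P m = P m × (∀ {k} → P k → k ≤ m)

IsMin : Pred ℕ p → ℕ → Set p
IsMin P m = P m × (∀ {k} → P k → k ≥ m)

record Matroid (p : Level) (n : ℕ) : Set (suc p) where
  field
    Basis    : Pred (Subset n) p
    nonempty : Satisfiable Basis
    exchange : ∀ {A B} → Basis A → Basis B → ∀ {e} → e ∈ A → e ∉ B →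
               ∃[ f ] (f ∈ B × f ∉ A × Basis ((A - e) ∪ ⁅ f ⁆))

-- The first n positions of Fin (n + ℓ) are E and the last ℓ are the new
-- elements, so S ∩ E, as a subset of E, is the prefix  take n S.
flat : (Q : Pred (Subset n) p) (r ℓ : ℕ) → Pred (Subset (n + ℓ)) p
flat {n = n} Q r ℓ S = ∣ S ∣ ≡ r × Q (take n S)

{-# OPTIONS --safe #-}

-- A convex delta-matroid Q has the augmentation property: if X, Y ∈ Q and
-- |X| < |Y|, then X ∪ {f} ∈ Q for some f ∈ Y \ X.  When X ⊆ Y this is
-- convexity; otherwise apply the delta-matroid axiom to (Y, X) and some
-- e ∈ X \ Y, which moves Y towards X without decreasing |Y| or adding to
-- Y \ X, and use induction on |X \ Y|.
--
-- For the exchange of e ∈ A \ B in the flattened family, suppose first that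
-- (A - e) ∩ E ∈ Q.  If B contains a new element outside A, insert it;
-- otherwise (A - e) ∩ E is smaller than B ∩ E, and augmentation provides an
-- element of E.  If (A - e) ∩ E is not known to be in Q, then e ∈ E, and the
-- delta-matroid axiom applied to A ∩ E, B ∩ E and e gives either a direct
-- exchange or, by convexity, (A - e) ∩ E ∈ Q after all.
module Submission where

open import Level using (Level)
open import Data.Nat using (ℕ; zero; suc; _+_; _∸_; _≤_; _<_; s≤s; s≤s⁻¹; z≤n)
open import Data.Nat.Properties
  using (≤-refl; ≤-reflexive; ≤-trans; ≤-antisym; <-≤-trans; <-irrefl; n≤1+n; +-suc;
         +-comm; +-identityʳ; +-monoʳ-≤; +-cancelʳ-<; module ≤-Reasoning)
open import Data.Fin using (Fin; zero; suc; _↑ˡ_; _↑ʳ_; splitAt)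
open import Data.Fin.Properties using (splitAt⁻¹-↑ˡ; splitAt⁻¹-↑ʳ)
open import Data.Fin.Subset
  using (Subset; inside; outside; _∈_; _∉_; _⊆_; _∪_; _─_; _-_; ⁅_⁆; ∣_∣; ⊥; Nonempty)
open import Data.Fin.Subset.Properties
  using (_∈?_; nonempty?; x∈⁅x⁆; x∈⁅y⁆⇒x≡y; ∣⁅x⁆∣≡1; ∣⊥∣≡0; ⊆-antisym;
         p⊆q⇒∣p∣≤∣q∣; p⊂q⇒∣p∣<∣q∣; p⊆p∪q; q⊆p∪q; x∈p∪q⁻; x∈p∪q⁺; ∪-identityʳ;
         p─⊥≡p; p─q⊆p; x∈p∧x∉q⇒x∈p─q; x∈p∧x≢y⇒x∈p-y; x∈p⇒∣p-x∣<∣p∣)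
open import Data.Product using (_×_; _,_; ∃-syntax)
open import Data.Sum using (_⊎_; inj₁; inj₂; [_,_]′; map)
open import Data.Vec using (_∷_; []; take; drop; _++_; here; there)
open import Data.Vec.Properties using (take-zipWith; take++drop≡id; ++-injectiveˡ)
open import Function using (id; _∘_)
open import Relation.Binary.PropositionalEquality
  using (_≡_; _≢_; refl; sym; trans; cong; cong₂; subst; module ≡-Reasoning)
open import Relation.Nullary using (¬_; yes; no; contradiction)
open import Relation.Nullary.Decidable using (decidable-stable)
open import Relation.Unary using (Pred; Satisfiable; _≐_)
open import Defs

private
  variable
    a : Level
    m n : ℕ
    p q : Subset n
    x e f : Fin n

-- Membership and cardinality in finite subsets

x∈p─q⇒x∉q : ∀ (p q : Subset n) → x ∈ p ─ q → x ∉ q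
x∈p─q⇒x∉q (_ ∷ p) (_ ∷ q) (there x∈p─q) (there x∈q) = x∈p─q⇒x∉q p q x∈p─q x∈q
x∈p─q⇒x∉q (inside  ∷ p) (inside ∷ q) () here
x∈p─q⇒x∉q (outside ∷ p) (inside ∷ q) () here

x∈p─q⁻ : ∀ (p q : Subset n) → x ∈ p ─ q → x ∈ p × x ∉ q
x∈p─q⁻ p q x∈p─q = p─q⊆p p q x∈p─q , x∈p─q⇒x∉q p q x∈p─q

x∈p-y⁻ : ∀ (p : Subset n) (y : Fin n) → x ∈ p - y → x ∈ p × x ≢ y
x∈p-y⁻ p y x∈p-y with x∈p , x∉⁅y⁆ ← x∈p─q⁻ p ⁅ y ⁆ x∈p-y =
  x∈p , λ { refl → x∉⁅y⁆ (x∈⁅x⁆ y) }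

x∈p△q⁻ : ∀ (p q : Subset n) → x ∈ p △ q → (x ∈ p × x ∉ q) ⊎ (x ∈ q × x ∉ p)
x∈p△q⁻ p q = map (x∈p─q⁻ p q) (x∈p─q⁻ q p) ∘ x∈p∪q⁻ (p ─ q) (q ─ p)

x∈p∧x∉q⇒x∈p△q : x ∈ p → x ∉ q → x ∈ p △ q
x∈p∧x∉q⇒x∈p△q x∈p x∉q = x∈p∪q⁺ (inj₁ (x∈p∧x∉q⇒x∈p─q x∈p x∉q))

x∉p∧x∈q⇒x∈p△q : x ∉ p → x ∈ q → x ∈ p △ q
x∉p∧x∈q⇒x∈p△q x∉p x∈q = x∈p∪q⁺ (inj₂ (x∈p∧x∉q⇒x∈p─q x∈q x∉p))

x∈⁅e⁆∪⁅f⁆⁻ : ∀ (e f : Fin n) → x ∈ ⁅ e ⁆ ∪ ⁅ f ⁆ → x ≡ e ⊎ x ≡ f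
x∈⁅e⁆∪⁅f⁆⁻ e f = map (x∈⁅y⁆⇒x≡y e) (x∈⁅y⁆⇒x≡y f) ∘ x∈p∪q⁻ ⁅ e ⁆ ⁅ f ⁆

e∈⁅e⁆∪⁅f⁆ : ∀ (e f : Fin n) → e ∈ ⁅ e ⁆ ∪ ⁅ f ⁆
e∈⁅e⁆∪⁅f⁆ e f = p⊆p∪q ⁅ f ⁆ (x∈⁅x⁆ e)

f∈⁅e⁆∪⁅f⁆ : ∀ (e f : Fin n) → f ∈ ⁅ e ⁆ ∪ ⁅ f ⁆
f∈⁅e⁆∪⁅f⁆ e f = q⊆p∪q ⁅ e ⁆ ⁅ f ⁆ (x∈⁅x⁆ f)

x∈p⇒x∈p△⁅e,f⁆ : x ∈ p → x ≢ e → x ≢ f → x ∈ p △ (⁅ e ⁆ ∪ ⁅ f ⁆)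
x∈p⇒x∈p△⁅e,f⁆ x∈p x≢e x≢f =
  x∈p∧x∉q⇒x∈p△q x∈p ([ x≢e , x≢f ]′ ∘ x∈⁅e⁆∪⁅f⁆⁻ _ _)

─-empty⇒⊆ : ¬ Nonempty (p ─ q) → p ⊆ q
─-empty⇒⊆ {q = q} empty {x} x∈p =
  decidable-stable (x ∈? q) λ x∉q → empty (x , x∈p∧x∉q⇒x∈p─q x∈p x∉q)

∣p∪q∣≤∣p∣+∣q∣ : ∀ (p q : Subset n) → ∣ p ∪ q ∣ ≤ ∣ p ∣ + ∣ q ∣
∣p∪q∣≤∣p∣+∣q∣ []            []            = z≤n
∣p∪q∣≤∣p∣+∣q∣ (outside ∷ p) (outside ∷ q) = ∣p∪q∣≤∣p∣+∣q∣ p q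
∣p∪q∣≤∣p∣+∣q∣ (outside ∷ p) (inside  ∷ q)
  rewrite +-suc ∣ p ∣ ∣ q ∣ = s≤s (∣p∪q∣≤∣p∣+∣q∣ p q)
∣p∪q∣≤∣p∣+∣q∣ (inside  ∷ p) (outside ∷ q) = s≤s (∣p∪q∣≤∣p∣+∣q∣ p q)
∣p∪q∣≤∣p∣+∣q∣ (inside  ∷ p) (inside  ∷ q) =
  s≤s (≤-trans (∣p∪q∣≤∣p∣+∣q∣ p q) (+-monoʳ-≤ ∣ p ∣ (n≤1+n ∣ q ∣)))

∣p∪⁅x⁆∣≤1+∣p∣ : ∀ (p : Subset n) x → ∣ p ∪ ⁅ x ⁆ ∣ ≤ suc ∣ p ∣
∣p∪⁅x⁆∣≤1+∣p∣ p x = ≤-trans (∣p∪q∣≤∣p∣+∣q∣ p ⁅ x ⁆)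
  (≤-reflexive (trans (cong (∣ p ∣ +_) (∣⁅x⁆∣≡1 x)) (+-comm ∣ p ∣ 1)))

x∉p⇒∣p∪⁅x⁆∣≡1+∣p∣ : ∀ (p : Subset n) x → x ∉ p → ∣ p ∪ ⁅ x ⁆ ∣ ≡ suc ∣ p ∣
x∉p⇒∣p∪⁅x⁆∣≡1+∣p∣ p x x∉p = ≤-antisym (∣p∪⁅x⁆∣≤1+∣p∣ p x)
  (p⊂q⇒∣p∣<∣q∣ (p⊆p∪q ⁅ x ⁆ , x , q⊆p∪q p ⁅ x ⁆ (x∈⁅x⁆ x) , x∉p))

-- Covers `x ∈ p` and `x ∉ p` alike, which spares `move-towards` a case split when it bounds the
-- size of `Y′`.
∣p∣≤1+∣p-x∣ : ∀ (p : Subset n) x → ∣ p ∣ ≤ suc ∣ p - x ∣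
∣p∣≤1+∣p-x∣ p x = ≤-trans (p⊆q⇒∣p∣≤∣q∣ p⊆) (∣p∪⁅x⁆∣≤1+∣p∣ (p - x) x)
  where
  p⊆ : p ⊆ (p - x) ∪ ⁅ x ⁆
  p⊆ {y} y∈p with y ∈? ⁅ x ⁆
  ... | yes y∈⁅x⁆ = q⊆p∪q (p - x) ⁅ x ⁆ y∈⁅x⁆
  ... | no  y∉⁅x⁆ = p⊆p∪q ⁅ x ⁆ (x∈p∧x∉q⇒x∈p─q y∈p y∉⁅x⁆)

∣p-e∪⁅f⁆∣≡∣p∣ : e ∈ p → f ∉ p → ∣ (p - e) ∪ ⁅ f ⁆ ∣ ≡ ∣ p ∣
∣p-e∪⁅f⁆∣≡∣p∣ {e = e} {p = p} {f = f} e∈p f∉p = trans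
  (x∉p⇒∣p∪⁅x⁆∣≡1+∣p∣ (p - e) f (f∉p ∘ p─q⊆p p ⁅ e ⁆))
  (≤-antisym (x∈p⇒∣p-x∣<∣p∣ e∈p) (∣p∣≤1+∣p-x∣ p e))

-- Augmentation

module _ {Q : Pred (Subset n) a} (convex : Convex Q) (delta : DeltaMatroid Q) where

  -- The inequality on `X ─ Y` makes the induction in `augment-bounded` descend. The inequality on
  -- `Y` keeps the target larger than `X`, and `Y′ ─ X ⊆ Y` turns an element that augments `X` from
  -- `Y′` into one from `Y`.
  move-towards : ∀ {X Y e} → Q X → Q Y → e ∈ X ─ Y →
    ∃[ Y′ ] (Q Y′ × ∣ X ─ Y′ ∣ < ∣ X ─ Y ∣ × ∣ Y ∣ ≤ ∣ Y′ ∣ × Y′ ─ X ⊆ Y)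
  move-towards {X} {Y} {e} QX QY e∈X─Y
    with e∈X , e∉Y ← x∈p─q⁻ X Y e∈X─Y
    with f , f∈Y△X , QY′ ← delta QY QX (x∉p∧x∈q⇒x∈p△q e∉Y e∈X) =
    Y′ , QY′ ,
    -- Strict because `e` leaves the difference: it now lies in `Y′`.
    p⊂q⇒∣p∣<∣q∣ (X─Y′⊆X─Y , e , e∈X─Y , λ e∈X─Y′ → x∈p─q⇒x∉q X Y′ e∈X─Y′ e∈Y′) ,
    -- At most `f` is lost and `e` is gained: `Y - f` is a proper subset of `Y′`.
    ≤-trans (∣p∣≤1+∣p-x∣ Y f)
      (p⊂q⇒∣p∣<∣q∣ (Y-f⊆Y′ , e , e∈Y′ , e∉Y ∘ p─q⊆p Y ⁅ f ⁆)) ,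
    Y′─X⊆Y
    where
    Y′ : Subset n
    Y′ = Y △ (⁅ e ⁆ ∪ ⁅ f ⁆)

    e∈Y′ : e ∈ Y′
    e∈Y′ = x∉p∧x∈q⇒x∈p△q e∉Y (e∈⁅e⁆∪⁅f⁆ e f)

    f∈X⇒f∉Y : f ∈ X → f ∉ Y
    f∈X⇒f∉Y f∈X f∈Y with x∈p△q⁻ Y X f∈Y△X
    ... | inj₁ (_ , f∉X) = f∉X f∈X
    ... | inj₂ (_ , f∉Y) = f∉Y f∈Y

    f∉X⇒f∈Y : f ∉ X → f ∈ Y
    f∉X⇒f∈Y f∉X with x∈p△q⁻ Y X f∈Y△X
    ... | inj₁ (f∈Y , _) = f∈Y
    ... | inj₂ (f∈X , _) = contradiction f∈X f∉X

    X─Y′⊆X─Y : X ─ Y′ ⊆ X ─ Y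
    X─Y′⊆X─Y x∈X─Y′ with x∈X , x∉Y′ ← x∈p─q⁻ X Y′ x∈X─Y′ =
      x∈p∧x∉q⇒x∈p─q x∈X λ x∈Y → x∉Y′ (x∈p⇒x∈p△⁅e,f⁆ x∈Y
        (λ { refl → e∉Y x∈Y }) (λ { refl → f∈X⇒f∉Y x∈X x∈Y }))

    Y-f⊆Y′ : Y - f ⊆ Y′
    Y-f⊆Y′ x∈Y-f with x∈Y , x≢f ← x∈p-y⁻ Y f x∈Y-f =
      x∈p⇒x∈p△⁅e,f⁆ x∈Y (λ { refl → e∉Y x∈Y }) x≢f

    Y′─X⊆Y : Y′ ─ X ⊆ Y
    Y′─X⊆Y x∈Y′─X with x∈Y′ , x∉X ← x∈p─q⁻ Y′ X x∈Y′─X with x∈p△q⁻ Y _ x∈Y′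
    ... | inj₁ (x∈Y , _) = x∈Y
    ... | inj₂ (x∈⁅e⁆∪⁅f⁆ , _) with x∈⁅e⁆∪⁅f⁆⁻ e f x∈⁅e⁆∪⁅f⁆
    ...   | inj₁ refl = contradiction e∈X x∉X
    ...   | inj₂ refl = f∉X⇒f∈Y x∉X

  augment-⊆ : ∀ {X Y} → X ⊆ Y → Q X → Q Y → ∣ X ∣ < ∣ Y ∣ →
              ∃[ f ] (f ∈ Y × f ∉ X × Q (X ∪ ⁅ f ⁆))
  augment-⊆ {X} {Y} X⊆Y QX QY ∣X∣<∣Y∣ with nonempty? (Y ─ X)
  ... | no Y─X-empty =
    contradiction (<-≤-trans ∣X∣<∣Y∣ (p⊆q⇒∣p∣≤∣q∣ (─-empty⇒⊆ Y─X-empty))) (<-irrefl refl)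
  ... | yes (f , f∈Y─X) with f∈Y , f∉X ← x∈p─q⁻ Y X f∈Y─X =
    f , f∈Y , f∉X , convex (p⊆p∪q ⁅ f ⁆) X∪⁅f⁆⊆Y QX QY
    where
    X∪⁅f⁆⊆Y : X ∪ ⁅ f ⁆ ⊆ Y
    X∪⁅f⁆⊆Y = [ X⊆Y , (λ x∈⁅f⁆ → subst (_∈ Y) (sym (x∈⁅y⁆⇒x≡y f x∈⁅f⁆)) f∈Y) ]′
            ∘ x∈p∪q⁻ X ⁅ f ⁆

  -- The bound `k` on the size of `X ─ Y` makes the recursion structural.
  augment-bounded : ∀ k {X Y} → ∣ X ─ Y ∣ ≤ k → Q X → Q Y → ∣ X ∣ < ∣ Y ∣ →
                    ∃[ f ] (f ∈ Y × f ∉ X × Q (X ∪ ⁅ f ⁆))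
  augment-bounded k {X} {Y} ∣X─Y∣≤k QX QY ∣X∣<∣Y∣ with nonempty? (X ─ Y)
  augment-bounded k ∣X─Y∣≤k QX QY ∣X∣<∣Y∣ | no X─Y-empty =
    augment-⊆ (─-empty⇒⊆ X─Y-empty) QX QY ∣X∣<∣Y∣
  augment-bounded zero ∣X─Y∣≤0 QX QY ∣X∣<∣Y∣ | yes (e , e∈X─Y)
    -- The element `e` makes `X ─ Y` nonempty, so its size cannot be 0.
    with () ← ≤-trans (x∈p⇒∣p-x∣<∣p∣ e∈X─Y) ∣X─Y∣≤0
  augment-bounded (suc k) ∣X─Y∣≤1+k QX QY ∣X∣<∣Y∣ | yes (e , e∈X─Y)
    with Y′ , QY′ , ∣X─Y′∣<∣X─Y∣ , ∣Y∣≤∣Y′∣ , Y′─X⊆Y ← move-towards QX QY e∈X─Y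
    with f , f∈Y′ , f∉X , QX∪⁅f⁆ ←
      augment-bounded k (s≤s⁻¹ (≤-trans ∣X─Y′∣<∣X─Y∣ ∣X─Y∣≤1+k)) QX QY′
        (<-≤-trans ∣X∣<∣Y∣ ∣Y∣≤∣Y′∣) =
    f , Y′─X⊆Y (x∈p∧x∉q⇒x∈p─q f∈Y′ f∉X) , f∉X , QX∪⁅f⁆

  augment : ∀ {X Y} → Q X → Q Y → ∣ X ∣ < ∣ Y ∣ →
            ∃[ f ] (f ∈ Y × f ∉ X × Q (X ∪ ⁅ f ⁆))
  augment = augment-bounded _ ≤-refl

  exchange-or-remove : ∀ {A B e} → Q A → Q B → e ∈ A → e ∉ B →
    Q (A - e) ⊎ ∃[ f ] (f ∈ B × f ∉ A × Q ((A - e) ∪ ⁅ f ⁆))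
  exchange-or-remove {A} {B} {e} QA QB e∈A e∉B
    with f , f∈A△B , QA′ ← delta QA QB (x∈p∧x∉q⇒x∈p△q e∈A e∉B)
    with x∈p△q⁻ A B f∈A△B
  -- Here `f` may equal `e`. Either way `A △ (⁅ e ⁆ ∪ ⁅ f ⁆)` only deletes elements of `A`, among
  -- them `e`, so `A - e` lies between it and `A`.
  ... | inj₁ (f∈A , _) = inj₁ (convex A′⊆A-e (p─q⊆p A ⁅ e ⁆) QA′ QA)
    where
    A′⊆A-e : A △ (⁅ e ⁆ ∪ ⁅ f ⁆) ⊆ A - e
    A′⊆A-e x∈A′ with x∈p△q⁻ A _ x∈A′
    ... | inj₁ (x∈A , x∉⁅e⁆∪⁅f⁆) =
      x∈p∧x≢y⇒x∈p-y x∈A λ { refl → x∉⁅e⁆∪⁅f⁆ (e∈⁅e⁆∪⁅f⁆ e f) }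
    ... | inj₂ (x∈⁅e⁆∪⁅f⁆ , x∉A) with x∈⁅e⁆∪⁅f⁆⁻ e f x∈⁅e⁆∪⁅f⁆
    ...   | inj₁ refl = contradiction e∈A x∉A
    ...   | inj₂ refl = contradiction f∈A x∉A
  -- Now `f` differs from `e`, and the symmetric difference removes `e` and inserts `f`.
  ... | inj₂ (f∈B , f∉A) = inj₂ (f , f∈B , f∉A , subst Q (⊆-antisym A′⊆ ⊆A′) QA′)
    where
    A′⊆ : A △ (⁅ e ⁆ ∪ ⁅ f ⁆) ⊆ (A - e) ∪ ⁅ f ⁆
    A′⊆ x∈A′ with x∈p△q⁻ A _ x∈A′
    ... | inj₁ (x∈A , x∉⁅e⁆∪⁅f⁆) = p⊆p∪q ⁅ f ⁆
      (x∈p∧x≢y⇒x∈p-y x∈A λ { refl → x∉⁅e⁆∪⁅f⁆ (e∈⁅e⁆∪⁅f⁆ e f) })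
    ... | inj₂ (x∈⁅e⁆∪⁅f⁆ , x∉A) with x∈⁅e⁆∪⁅f⁆⁻ e f x∈⁅e⁆∪⁅f⁆
    ...   | inj₁ refl = contradiction e∈A x∉A
    ...   | inj₂ refl = q⊆p∪q (A - e) ⁅ f ⁆ (x∈⁅x⁆ f)

    ⊆A′ : (A - e) ∪ ⁅ f ⁆ ⊆ A △ (⁅ e ⁆ ∪ ⁅ f ⁆)
    ⊆A′ x∈ with x∈p∪q⁻ (A - e) ⁅ f ⁆ x∈
    ... | inj₁ x∈A-e with x∈A , x≢e ← x∈p-y⁻ A e x∈A-e =
      x∈p⇒x∈p△⁅e,f⁆ x∈A x≢e λ { refl → f∉A x∈A }
    ... | inj₂ x∈⁅f⁆ with refl ← x∈⁅y⁆⇒x≡y f x∈⁅f⁆ =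
      x∉p∧x∈q⇒x∈p△q f∉A (f∈⁅e⁆∪⁅f⁆ e f)

-- Subsets of a disjoint union

∣p++q∣≡∣p∣+∣q∣ : ∀ (p : Subset m) (q : Subset n) → ∣ p ++ q ∣ ≡ ∣ p ∣ + ∣ q ∣
∣p++q∣≡∣p∣+∣q∣ []            q = refl
∣p++q∣≡∣p∣+∣q∣ (outside ∷ p) q = ∣p++q∣≡∣p∣+∣q∣ p q
∣p++q∣≡∣p∣+∣q∣ (inside  ∷ p) q = cong suc (∣p++q∣≡∣p∣+∣q∣ p q)

∣p∣≡∣take∣+∣drop∣ : ∀ m (p : Subset (m + n)) → ∣ p ∣ ≡ ∣ take m p ∣ + ∣ drop m p ∣
∣p∣≡∣take∣+∣drop∣ m p = trans (cong ∣_∣ (sym (take++drop≡id m p)))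
  (∣p++q∣≡∣p∣+∣q∣ (take m p) (drop m p))

-- With at least as many new elements in `p` as in `q`, the deficit of `p` must come from the first
-- `m` positions.
drop⊇⇒∣take∣<∣take∣ : ∀ m (p q : Subset (m + n)) → drop m q ⊆ drop m p →
                       ∣ p ∣ < ∣ q ∣ → ∣ take m p ∣ < ∣ take m q ∣
drop⊇⇒∣take∣<∣take∣ m p q drop⊆ ∣p∣<∣q∣ = +-cancelʳ-< ∣ drop m p ∣ _ _ (begin-strict
  ∣ take m p ∣ + ∣ drop m p ∣  ≡⟨ ∣p∣≡∣take∣+∣drop∣ m p ⟨
  ∣ p ∣                        <⟨ ∣p∣<∣q∣ ⟩
  ∣ q ∣                        ≡⟨ ∣p∣≡∣take∣+∣drop∣ m q ⟩
  ∣ take m q ∣ + ∣ drop m q ∣  ≤⟨ +-monoʳ-≤ ∣ take m q ∣ (p⊆q⇒∣p∣≤∣q∣ drop⊆) ⟩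
  ∣ take m q ∣ + ∣ drop m p ∣  ∎)
  where open ≤-Reasoning

take-++ : ∀ (p : Subset m) (q : Subset n) → take m (p ++ q) ≡ p
take-++ {m} p q = ++-injectiveˡ (take m (p ++ q)) p (take++drop≡id m (p ++ q))

∈-take⁺ : ∀ {x : Fin m} (p : Subset (m + n)) → x ↑ˡ n ∈ p → x ∈ take m p
∈-take⁺ {x = zero}  (_ ∷ p) here        = here
∈-take⁺ {x = suc x} (_ ∷ p) (there x∈p) = there (∈-take⁺ p x∈p)

∈-take⁻ : ∀ {x : Fin m} (p : Subset (m + n)) → x ∈ take m p → x ↑ˡ n ∈ p
∈-take⁻ {x = zero}  (_ ∷ p) here        = here
∈-take⁻ {x = suc x} (_ ∷ p) (there x∈p) = there (∈-take⁻ p x∈p)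

∈-drop⁺ : ∀ m {x : Fin n} (p : Subset (m + n)) → m ↑ʳ x ∈ p → x ∈ drop m p
∈-drop⁺ zero    p       x∈p         = x∈p
∈-drop⁺ (suc m) (_ ∷ p) (there x∈p) = ∈-drop⁺ m p x∈p

∈-drop⁻ : ∀ m {x : Fin n} (p : Subset (m + n)) → x ∈ drop m p → m ↑ʳ x ∈ p
∈-drop⁻ zero    p       x∈p = x∈p
∈-drop⁻ (suc m) (_ ∷ p) x∈p = there (∈-drop⁻ m p x∈p)

take-⊥ : ∀ m → take m (⊥ {m + n}) ≡ ⊥
take-⊥ zero    = refl
take-⊥ (suc m) = cong (outside ∷_) (take-⊥ m)

take-⁅x↑ˡn⁆ : ∀ (x : Fin m) → take m ⁅ x ↑ˡ n ⁆ ≡ ⁅ x ⁆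
take-⁅x↑ˡn⁆ {suc m} zero    = cong (inside ∷_) (take-⊥ m)
take-⁅x↑ˡn⁆ {suc m} (suc x) = cong (outside ∷_) (take-⁅x↑ˡn⁆ x)

take-⁅m↑ʳx⁆ : ∀ m (x : Fin n) → take m ⁅ m ↑ʳ x ⁆ ≡ ⊥
take-⁅m↑ʳx⁆ zero    x = refl
take-⁅m↑ʳx⁆ (suc m) x = cong (outside ∷_) (take-⁅m↑ʳx⁆ m x)

take-p∪⁅x↑ˡn⁆ : ∀ (p : Subset (m + n)) x → take m (p ∪ ⁅ x ↑ˡ n ⁆) ≡ take m p ∪ ⁅ x ⁆
take-p∪⁅x↑ˡn⁆ {m} p x =
  trans (take-zipWith _ p _) (cong (take m p ∪_) (take-⁅x↑ˡn⁆ x))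

take-p∪⁅m↑ʳx⁆ : ∀ (p : Subset (m + n)) x → take m (p ∪ ⁅ m ↑ʳ x ⁆) ≡ take m p
take-p∪⁅m↑ʳx⁆ {m} p x = trans (take-zipWith _ p _)
  (trans (cong (take m p ∪_) (take-⁅m↑ʳx⁆ m x)) (∪-identityʳ (take m p)))

take-p-[x↑ˡn] : ∀ (p : Subset (m + n)) x → take m (p - (x ↑ˡ n)) ≡ take m p - x
take-p-[x↑ˡn] {m} p x =
  trans (take-zipWith _ p _) (cong (take m p ─_) (take-⁅x↑ˡn⁆ x))

take-p-[m↑ʳx] : ∀ (p : Subset (m + n)) x → take m (p - (m ↑ʳ x)) ≡ take m p
take-p-[m↑ʳx] {m} p x = trans (take-zipWith _ p _)
  (trans (cong (take m p ─_) (take-⁅m↑ʳx⁆ m x)) (p─⊥≡p (take m p)))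

-- The flattened family

module _ {Q : Pred (Subset n) a} (convex : Convex Q) (delta : DeltaMatroid Q)
         (r ℓ : ℕ) where

  Exchange : (A B : Subset (n + ℓ)) → Fin (n + ℓ) → Set a
  Exchange A B e = ∃[ f ] (f ∈ B × f ∉ A × flat Q r ℓ ((A - e) ∪ ⁅ f ⁆))

  -- Serves both a new element `e` and an `e` in the ground set; only the trace of `A - e` on the
  -- ground set matters.
  exchange-from-removal : ∀ {A B e} → flat Q r ℓ A → flat Q r ℓ B → e ∈ A → e ∉ B →
                          Q (take n (A - e)) → Exchange A B e
  exchange-from-removal {A} {B} {e} (∣A∣≡r , _) (∣B∣≡r , QB) e∈A e∉B QA-e
    with nonempty? (drop n B ─ drop n A)
  ... | yes (x , x∈) with x∈B , x∉A ← x∈p─q⁻ (drop n B) (drop n A) x∈ =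
    -- Inserting a new element restores the size and leaves the trace unchanged.
    n ↑ʳ x , ∈-drop⁻ n B x∈B , x∉A ∘ ∈-drop⁺ n A ,
    trans (∣p-e∪⁅f⁆∣≡∣p∣ e∈A (x∉A ∘ ∈-drop⁺ n A)) ∣A∣≡r ,
    subst Q (sym (take-p∪⁅m↑ʳx⁆ (A - e) x)) QA-e
  ... | no empty
    with x , x∈B , x∉A-e , QA-e∪⁅x⁆ ← augment convex delta QA-e QB
      (drop⊇⇒∣take∣<∣take∣ n (A - e) B
        -- Every new element of `B` lies in `A`, and it is not `e` because `e ∉ B`, so it survives
        -- in `A - e`.
        (λ x∈B → ∈-drop⁺ n (A - e) (x∈p∧x≢y⇒x∈p-y
          (∈-drop⁻ n A (─-empty⇒⊆ empty x∈B))
          (λ { refl → e∉B (∈-drop⁻ n B x∈B) })))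
        (<-≤-trans (x∈p⇒∣p-x∣<∣p∣ e∈A) (≤-reflexive (trans ∣A∣≡r (sym ∣B∣≡r))))) =
    x ↑ˡ ℓ , ∈-take⁻ B x∈B , x∉A ,
    trans (∣p-e∪⁅f⁆∣≡∣p∣ e∈A x∉A) ∣A∣≡r ,
    subst Q (sym (take-p∪⁅x↑ˡn⁆ (A - e) x)) QA-e∪⁅x⁆
    where
    x∉A : x ↑ˡ ℓ ∉ A
    -- Augmentation only excludes `x` from `A - e`; the remaining possibility, that `x` is `e`,
    -- contradicts `e ∉ B`.
    x∉A x∈A = x∉A-e (∈-take⁺ (A - e)
      (x∈p∧x≢y⇒x∈p-y x∈A λ { refl → e∉B (∈-take⁻ B x∈B) }))

  flat-exchange : ∀ {A B} → flat Q r ℓ A → flat Q r ℓ B → ∀ {e} → e ∈ A → e ∉ B →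
                  Exchange A B e
  flat-exchange {A} {B} FA@(∣A∣≡r , QA) FB@(_ , QB) {e} e∈A e∉B with splitAt n e in eq
  ... | inj₂ x with refl ← splitAt⁻¹-↑ʳ {n} eq =
    -- Removing a new element leaves the trace of `A`, which is in `Q`.
    exchange-from-removal FA FB e∈A e∉B (subst Q (sym (take-p-[m↑ʳx] A x)) QA)
  ... | inj₁ x with refl ← splitAt⁻¹-↑ˡ {n} eq
    with exchange-or-remove convex delta QA QB (∈-take⁺ A e∈A) (e∉B ∘ ∈-take⁻ B)
  ...   | inj₁ QA-x = exchange-from-removal FA FB e∈A e∉B (subst Q (sym (take-p-[x↑ˡn] A x)) QA-x)
  ...   | inj₂ (y , y∈B , y∉A , QA-x∪⁅y⁆) =
    y ↑ˡ ℓ , ∈-take⁻ B y∈B , y∉A ∘ ∈-take⁺ A ,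
    trans (∣p-e∪⁅f⁆∣≡∣p∣ e∈A (y∉A ∘ ∈-take⁺ A)) ∣A∣≡r ,
    subst Q (sym (trans (take-p∪⁅x↑ˡn⁆ (A - (x ↑ˡ ℓ)) y)
                        (cong (_∪ ⁅ y ⁆) (take-p-[x↑ˡn] A x)))) QA-x∪⁅y⁆

theorem4p12 : {p : Level} (n : ℕ) (Q : Pred (Subset n) p) →
    Satisfiable Q → Convex Q → DeltaMatroid Q →
    (r s : ℕ) → IsMax (Sizes Q) r → IsMin (Sizes Q) s →
    ∃[ M ] (Matroid.Basis {p} {n + (r ∸ s)} M ≐ flat Q r (r ∸ s))
theorem4p12 n Q _ convex delta r s ((S , QS , ∣S∣≡r) , _) _ = M , id , id
  where
  M : Matroid _ (n + (r ∸ s))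
  M = record
    { Basis    = flat Q r (r ∸ s)
    -- The maximum `r` is attained by `S`, which is thus a basis when no new element is added.
    ; nonempty = S ++ ⊥ ,
        (begin
          ∣ S ++ ⊥ ∣                ≡⟨ ∣p++q∣≡∣p∣+∣q∣ S ⊥ ⟩
          ∣ S ∣ + ∣ ⊥ {r ∸ s} ∣     ≡⟨ cong₂ _+_ ∣S∣≡r (∣⊥∣≡0 (r ∸ s)) ⟩
          r + 0                     ≡⟨ +-identityʳ r ⟩
          r                         ∎) ,
        subst Q (sym (take-++ S ⊥)) QS
    ; exchange = flat-exchange convex delta r (r ∸ s)
    }
    where open ≡-Reasoning
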